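{- $\mathrm{NON}\equiv_{\mathrm{sW}}\Pi(\mathrm{DIS})$, i.e., the non-computability problem is strongly Weihrauch equivalent to the parallelization of the discontinuity problem.
   Context: A represented space is a set $X$ with a partial surjective map $\delta_X:\subseteq\mathbb N^{\mathbb N}\to X$. A problem is a partial multi-valued function $f:\subseteq X\rightrightarrows Y$ between represented spaces that has a realizer; a realizer of $f$ is a function $F:\subseteq\mathbb N^{\mathbb N}\to\mathbb N^{\mathbb N}$ with $\delta_YF(p)\in f\delta_X(p)$ for all $p\in\mathrm{dom}(f\delta_X)$. For problems $f,g$: $f\leq_{\mathrm{sW}}g$ if there are computable $H,K:\subseteq\mathbb N^{\mathbb N}\to\mathbb N^{\mathbb N}$ such that $HGK$ is a realizer of $f$ whenever $G$ is a realizer of $g$; $f\equiv_{\mathrm{sW}}g$ means $f\leq_{\mathrm{sW}}g$ and $g\leq_{\mathrm{sW}}f$. $\mathbb N^{\mathbb N}$ is represented by the identity. The space $X^{\mathbb N}$ is represented by $\langle p_0,p_1,\dots\rangle\mapsto(\delta_X(p_n))_n$, where $\langle p_0,p_1,\dots\rangle\langle n,k\rangle:=p_n(k)$ and $\langle n,k\rangle:=\frac12(n+k)(n+k+1)+k$ for $n,k\in\mathbb N$. Parallelization: for $f:\subseteq X\rightrightarrows Y$, $\Pi f:\subseteq X^{\mathbb N}\rightrightarrows Y^{\mathbb N}$ (also written $\widehat f$) has $\mathrm{dom}(\Pi f)=\mathrm{dom}(f)^{\mathbb N}$ and $\Pi f((x_n)_n)=\{(y_n)_n:(\forall n)\ y_n\in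 f(x_n)\}$. $\varphi^p$ is a standard Gödel numbering of the partial functions $\varphi^p_i:\subseteq\mathbb N\to\mathbb N$ computable relative to the oracle $p$. $\langle p,q\rangle(2n)=p(n)$, $\langle p,q\rangle(2n+1)=q(n)$ for $p,q\in\mathbb N^{\mathbb N}$; $\langle i,r\rangle:=ir$ (concatenation) for $i\in\mathbb N$, $r\in\mathbb N^{\mathbb N}$. The universal function $\mathrm U:\subseteq\mathbb N^{\mathbb N}\to\mathbb N^{\mathbb N}$ is $\mathrm U\langle\langle i,r\rangle,p\rangle:=\varphi_i^{\langle r,p\rangle}$ if $\varphi_i^{\langle r,p\rangle}$ is total, and undefined otherwise. $\mathrm{DIS}:\mathbb N^{\mathbb N}\rightrightarrows\mathbb N^{\mathbb N}$, $p\mapsto\{q:\mathrm U(p)\neq q\}$ (every $q$ is a solution if $\mathrm U(p)$ is undefined). $\mathrm{NON}:\mathbb N^{\mathbb N}\rightrightarrows\mathbb N^{\mathbb N}$, $p\mapsto\{q:q\not\leq_{\mathrm T}p\}$, where $\leq_{\mathrm T}$ is Turing reducibility. -}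

module Defs where

open import Level using (0ℓ)
open import Data.Nat using (ℕ; zero; suc; _+_; _*_; _/_; _<_; ⌊_/2⌋; parity)
open import Data.Nat.Properties
  using (+-suc; +-identityʳ; suc-injective; <-cmp; 0≢1+n)
open import Data.Nat.Divisibility using (divides-refl)
open import Data.Nat.DivMod using (m*n/n≡m; +-distrib-/-∣ʳ)
open import Data.Nat.Solver using (module +-*-Solver)
open import Data.Parity.Base using (0ℙ; 1ℙ)
open import Data.Product using (Σ; ∃-syntax; _×_; _,_; proj₁; proj₂)
open import Data.Unit using (⊤; tt)
open import Function using (_∘_)
open import Relation.Binary using (Setoid; tri<; tri≈; tri>)
open import Relation.Binary.PropositionalEquality
open import Relation.Nullary using (¬_; contradiction)

⟨_,_⟩ : ℕ → ℕ → ℕ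
⟨ n , k ⟩ = (n + k) * (n + k + 1) / 2 + k

-- The successor of a pair in the Cantor enumeration of ℕ × ℕ.
next : ℕ × ℕ → ℕ × ℕ
next (zero  , k) = suc k , zero
next (suc n , k) = n , suc k

unpair : ℕ → ℕ × ℕ
unpair zero    = zero , zero
unpair (suc m) = next (unpair m)

π₁ π₂ : ℕ → ℕ
π₁ = proj₁ ∘ unpair
π₂ = proj₂ ∘ unpair

private
  triangle-suc : ∀ s → suc s * (suc s + 1) / 2 ≡ suc (s * (s + 1) / 2 + s)
  triangle-suc s = begin
    suc s * (suc s + 1) / 2          ≡⟨ cong (_/ 2) (lemma s) ⟩
    (s * (s + 1) + suc s * 2) / 2    ≡⟨ +-distrib-/-∣ʳ (s * (s + 1)) (divides-refl (suc s)) ⟩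
    s * (s + 1) / 2 + suc s * 2 / 2  ≡⟨ cong (s * (s + 1) / 2 +_) (m*n/n≡m (suc s) 2) ⟩
    s * (s + 1) / 2 + suc s          ≡⟨ +-suc _ s ⟩
    suc (s * (s + 1) / 2 + s)        ∎
    where
    open ≡-Reasoning
    open +-*-Solver
    lemma : ∀ s → suc s * (suc s + 1) ≡ s * (s + 1) + suc s * 2
    lemma = solve 1 (λ s → (con 1 :+ s) :* ((con 1 :+ s) :+ con 1)
                        := s :* (s :+ con 1) :+ (con 1 :+ s) :* con 2) refl

  pair-suc-zero : ∀ n → ⟨ suc n , 0 ⟩ ≡ suc ⟨ 0 , n ⟩
  pair-suc-zero n rewrite +-identityʳ n | +-identityʳ (suc n * (suc n + 1) / 2) = triangle-suc n

  pair-suc : ∀ n k → ⟨ n , suc k ⟩ ≡ suc ⟨ suc n , k ⟩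
  pair-suc n k rewrite +-suc n k = +-suc _ k

  unpair-unique : ∀ m n k → ⟨ n , k ⟩ ≡ m → unpair m ≡ (n , k)
  unpair-unique zero    zero    zero    _  = refl
  unpair-unique zero    (suc n) zero    eq = contradiction (trans (sym eq) (pair-suc-zero n)) 0≢1+n
  unpair-unique zero    n       (suc k) eq = contradiction (trans (sym eq) (pair-suc n k)) 0≢1+n
  unpair-unique (suc m) zero    zero    ()
  unpair-unique (suc m) (suc n) zero    eq =
    cong next (unpair-unique m zero n (suc-injective (trans (sym (pair-suc-zero n)) eq)))
  unpair-unique (suc m) n       (suc k) eq =
    cong next (unpair-unique m (suc n) k (suc-injective (trans (sym (pair-suc n k)) eq)))

unpair-pair : ∀ n k → unpair ⟨ n , k ⟩ ≡ (n , k)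
unpair-pair n k = unpair-unique ⟨ n , k ⟩ n k refl

π₁-pair : ∀ n k → π₁ ⟨ n , k ⟩ ≡ n
π₁-pair n k = cong proj₁ (unpair-pair n k)

π₂-pair : ∀ n k → π₂ ⟨ n , k ⟩ ≡ k
π₂-pair n k = cong proj₂ (unpair-pair n k)

Baire : Set
Baire = ℕ → ℕ

𝒩 : Setoid 0ℓ 0ℓ
𝒩 = ℕ →-setoid ℕ

-- ⟪ p , q ⟫ (2n) = p n  and  ⟪ p , q ⟫ (2n+1) = q n
⟪_,_⟫ : Baire → Baire → Baire
⟪ p , q ⟫ n with parity n
... | 0ℙ = p ⌊ n /2⌋
... | 1ℙ = q ⌊ n /2⌋

⟪⟫-cong : ∀ {p p′ q q′} → p ≗ p′ → q ≗ q′ → ⟪ p , q ⟫ ≗ ⟪ p′ , q′ ⟫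
⟪⟫-cong p≗ q≗ n with parity n
... | 0ℙ = p≗ ⌊ n /2⌋
... | 1ℙ = q≗ ⌊ n /2⌋

⟪⟫-step : ∀ p q n → ⟪ p , q ⟫ (suc (suc n)) ≡ ⟪ p ∘ suc , q ∘ suc ⟫ n
⟪⟫-step p q n with parity n
... | 0ℙ = refl
... | 1ℙ = refl

evens odds : Baire → Baire
evens x n = x (2 * n)
odds  x n = x (2 * n + 1)

evens-⟪⟫ : ∀ p q → evens ⟪ p , q ⟫ ≗ p
evens-⟪⟫ p q zero = refl
evens-⟪⟫ p q (suc n) rewrite +-suc n (n + 0) = trans (⟪⟫-step p q (2 * n)) (evens-⟪⟫ (p ∘ suc) (q ∘ suc) n)

odds-⟪⟫ : ∀ p q → odds ⟪ p , q ⟫ ≗ q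
odds-⟪⟫ p q zero = refl
odds-⟪⟫ p q (suc n) rewrite +-suc n (n + 0) = trans (⟪⟫-step p q (2 * n + 1)) (odds-⟪⟫ (p ∘ suc) (q ∘ suc) n)

-- Partial recursive functions relative to an oracle.  Programs compute
-- unary functions; several arguments are passed through Cantor pairing.
data Code : Set where
  zeroᶜ succᶜ leftᶜ rightᶜ oracleᶜ : Code
  pairᶜ compᶜ precᶜ : Code → Code → Code
  rfindᶜ : Code → Code

-- Graphs of partial functions obtained by primitive recursion
-- h(a,0) = f(a), h(a,k+1) = g⟨a,⟨k,h(a,k)⟩⟩, and by minimization
-- h(n) = least m with f⟨n,m⟩ = 0 (and f⟨n,k⟩ defined for all k < m).
Prec : (F G : ℕ → ℕ → Set) → ℕ → ℕ → ℕ → Set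
Prec F G a zero    m = F a m
Prec F G a (suc k) m = ∃[ r ] Prec F G a k r × G ⟨ a , ⟨ k , r ⟩ ⟩ m

Rfind : (F : ℕ → ℕ → Set) → ℕ → ℕ → Set
Rfind F n m = F ⟨ n , m ⟩ 0 × (∀ k → k < m → ∃[ v ] F ⟨ n , k ⟩ (suc v))

-- ⟦ c ⟧ p n m : program c with oracle p halts on input n with output m.
⟦_⟧ : Code → Baire → ℕ → ℕ → Set
⟦ zeroᶜ ⟧     p n m = m ≡ 0
⟦ succᶜ ⟧     p n m = m ≡ suc n
⟦ leftᶜ ⟧     p n m = m ≡ π₁ n
⟦ rightᶜ ⟧    p n m = m ≡ π₂ n
⟦ oracleᶜ ⟧   p n m = m ≡ p n
⟦ pairᶜ f g ⟧ p n m = ∃[ a ] ∃[ b ] ⟦ f ⟧ p n a × ⟦ g ⟧ p n b × m ≡ ⟨ a , b ⟩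
⟦ compᶜ f g ⟧ p n m = ∃[ k ] ⟦ g ⟧ p n k × ⟦ f ⟧ p k m
⟦ precᶜ f g ⟧ p n m = Prec (⟦ f ⟧ p) (⟦ g ⟧ p) (π₁ n) (π₂ n) m
⟦ rfindᶜ f ⟧  p n m = Rfind (⟦ f ⟧ p) n m

⟦⟧-functional : ∀ c p {n m m′} → ⟦ c ⟧ p n m → ⟦ c ⟧ p n m′ → m ≡ m′
⟦⟧-functional zeroᶜ   p refl refl = refl
⟦⟧-functional succᶜ   p refl refl = refl
⟦⟧-functional leftᶜ   p refl refl = refl
⟦⟧-functional rightᶜ  p refl refl = refl
⟦⟧-functional oracleᶜ p refl refl = refl
⟦⟧-functional (pairᶜ f g) p (a , b , fa , gb , refl) (a′ , b′ , fa′ , gb′ , refl) =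
  cong₂ ⟨_,_⟩ (⟦⟧-functional f p fa fa′) (⟦⟧-functional g p gb gb′)
⟦⟧-functional (compᶜ f g) p (k , gk , fm) (k′ , gk′ , fm′)
  with refl ← ⟦⟧-functional g p gk gk′ = ⟦⟧-functional f p fm fm′
⟦⟧-functional (precᶜ f g) p {n} = go (π₂ n)
  where
  go : ∀ k {m m′} → Prec (⟦ f ⟧ p) (⟦ g ⟧ p) (π₁ n) k m →
       Prec (⟦ f ⟧ p) (⟦ g ⟧ p) (π₁ n) k m′ → m ≡ m′
  go zero    fm fm′ = ⟦⟧-functional f p fm fm′
  go (suc k) (r , hr , gm) (r′ , hr′ , gm′)
    with refl ← go k hr hr′ = ⟦⟧-functional g p gm gm′
⟦⟧-functional (rfindᶜ f) p {n} {m} {m′} (fm , below) (fm′ , below′) with <-cmp m m′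
... | tri≈ _ eq _ = eq
... | tri< m<m′ _ _ = contradiction (⟦⟧-functional f p fm (proj₂ (below′ m m<m′))) 0≢1+n
... | tri> _ _ m′<m = contradiction (⟦⟧-functional f p fm′ (proj₂ (below m′ m′<m))) 0≢1+n

⟦⟧-resp : ∀ c {p p′ n m} → p ≗ p′ → ⟦ c ⟧ p n m → ⟦ c ⟧ p′ n m
⟦⟧-resp zeroᶜ   p≗ e = e
⟦⟧-resp succᶜ   p≗ e = e
⟦⟧-resp leftᶜ   p≗ e = e
⟦⟧-resp rightᶜ  p≗ e = e
⟦⟧-resp oracleᶜ {n = n} p≗ e = trans e (p≗ n)
⟦⟧-resp (pairᶜ f g) p≗ (a , b , fa , gb , e) = a , b , ⟦⟧-resp f p≗ fa , ⟦⟧-resp g p≗ gb , e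
⟦⟧-resp (compᶜ f g) p≗ (k , gk , fm) = k , ⟦⟧-resp g p≗ gk , ⟦⟧-resp f p≗ fm
⟦⟧-resp (precᶜ f g) {p} {p′} {n} p≗ = go (π₂ n)
  where
  go : ∀ k {m} → Prec (⟦ f ⟧ p) (⟦ g ⟧ p) (π₁ n) k m → Prec (⟦ f ⟧ p′) (⟦ g ⟧ p′) (π₁ n) k m
  go zero    fm           = ⟦⟧-resp f p≗ fm
  go (suc k) (r , hr , gm) = r , go k hr , ⟦⟧-resp g p≗ gm
⟦⟧-resp (rfindᶜ f) p≗ (fm , below) =
  ⟦⟧-resp f p≗ fm , λ k k<m → proj₁ (below k k<m) , ⟦⟧-resp f p≗ (proj₂ (below k k<m))

tag : Code → ℕ
tag zeroᶜ       = 0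
tag succᶜ       = 1
tag leftᶜ       = 2
tag rightᶜ      = 3
tag oracleᶜ     = 4
tag (pairᶜ _ _) = 5
tag (compᶜ _ _) = 6
tag (precᶜ _ _) = 7
tag (rfindᶜ _)  = 8

mutual
  gödel : Code → ℕ
  gödel c = ⟨ tag c , body c ⟩

  body : Code → ℕ
  body (pairᶜ f g) = ⟨ gödel f , gödel g ⟩
  body (compᶜ f g) = ⟨ gödel f , gödel g ⟩
  body (precᶜ f g) = ⟨ gödel f , gödel g ⟩
  body (rfindᶜ f)  = gödel f
  body _           = 0

private
  pair-injective : ∀ a b c d → ⟨ a , b ⟩ ≡ ⟨ c , d ⟩ → a ≡ c × b ≡ d
  pair-injective a b c d eq =
    trans (sym (π₁-pair a b)) (trans (cong π₁ eq) (π₁-pair c d)) ,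
    trans (sym (π₂-pair a b)) (trans (cong π₂ eq) (π₂-pair c d))

mutual
  gödel-injective : ∀ c d → gödel c ≡ gödel d → c ≡ d
  gödel-injective c d eq with pair-injective (tag c) (body c) (tag d) (body d) eq
  ... | e , e′ = tag-body c d e e′

  private
    tag-body : ∀ c d → tag c ≡ tag d → body c ≡ body d → c ≡ d
    tag-body zeroᶜ   zeroᶜ   _ _ = refl
    tag-body succᶜ   succᶜ   _ _ = refl
    tag-body leftᶜ   leftᶜ   _ _ = refl
    tag-body rightᶜ  rightᶜ  _ _ = refl
    tag-body oracleᶜ oracleᶜ _ _ = refl
    tag-body (pairᶜ f g) (pairᶜ f′ g′) _ eq
      with pair-injective (gödel f) (gödel g) (gödel f′) (gödel g′) eq
    ... | e , e′ = cong₂ pairᶜ (gödel-injective f f′ e) (gödel-injective g g′ e′)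
    tag-body (compᶜ f g) (compᶜ f′ g′) _ eq
      with pair-injective (gödel f) (gödel g) (gödel f′) (gödel g′) eq
    ... | e , e′ = cong₂ compᶜ (gödel-injective f f′ e) (gödel-injective g g′ e′)
    tag-body (precᶜ f g) (precᶜ f′ g′) _ eq
      with pair-injective (gödel f) (gödel g) (gödel f′) (gödel g′) eq
    ... | e , e′ = cong₂ precᶜ (gödel-injective f f′ e) (gödel-injective g g′ e′)
    tag-body (rfindᶜ f) (rfindᶜ f′) _ eq = cong rfindᶜ (gödel-injective f f′ eq)

-- The graph of φᵢᵖ; it is nowhere defined if i is not the number of a program.
φ : ℕ → Baire → ℕ → ℕ → Set
φ i p n m = ∃[ c ] gödel c ≡ i × ⟦ c ⟧ p n m

φ-functional : ∀ i p {n m m′} → φ i p n m → φ i p n m′ → m ≡ m′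
φ-functional i p (c , e , h) (c′ , e′ , h′)
  with refl ← gödel-injective c c′ (trans e (sym e′)) = ⟦⟧-functional c p h h′

φ-resp : ∀ {i i′ p p′ n m} → i ≡ i′ → p ≗ p′ → φ i p n m → φ i′ p′ n m
φ-resp refl p≗ (c , e , h) = c , e , ⟦⟧-resp c p≗ h

infix 4 _≤T_
_≤T_ : Baire → Baire → Set
q ≤T p = ∃[ i ] ∀ n → φ i p n (q n)

≤T-resp : ∀ {p p′ q q′} → p ≗ p′ → q ≗ q′ → q ≤T p → q′ ≤T p′
≤T-resp p≗ q≗ (i , h) = i , λ n → φ-resp refl p≗ (subst (φ i _ n) (q≗ n) (h n))

infix 3 _⇀_
record _⇀_ (A B : Setoid 0ℓ 0ℓ) : Set₁ where
  private
    module A = Setoid A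
    module B = Setoid B
  field
    Dom      : A.Carrier → Set
    Dom-resp : ∀ {x y} → x A.≈ y → Dom x → Dom y
    app      : ∀ x → Dom x → B.Carrier
    app-cong : ∀ {x y} → x A.≈ y → (d : Dom x) (e : Dom y) → app x d B.≈ app y e

open _⇀_ public

infixr 9 _∘ₚ_
_∘ₚ_ : ∀ {A B C} → B ⇀ C → A ⇀ B → A ⇀ C
(F ∘ₚ G) .Dom x = Σ (Dom G x) λ d → Dom F (app G x d)
(F ∘ₚ G) .Dom-resp x≈y (d , e) =
  Dom-resp G x≈y d , Dom-resp F (app-cong G x≈y d (Dom-resp G x≈y d)) e
(F ∘ₚ G) .app x (d , e) = app F (app G x d) e
(F ∘ₚ G) .app-cong x≈y (d , e) (d′ , e′) = app-cong F (app-cong G x≈y d d′) e e′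

idₚ : ∀ {A} → A ⇀ A
idₚ .Dom _ = ⊤
idₚ .Dom-resp _ _ = tt
idₚ .app x _ = x
idₚ .app-cong x≈y _ _ = x≈y

-- As usual, nothing is required of the program on oracles outside Dom F.
Computable : 𝒩 ⇀ 𝒩 → Set
Computable F = ∃[ i ] ∀ p (d : Dom F p) n → φ i p n (app F p d n)

-- Every x is ⟪ ⟨i,r⟩ , p ⟫ with ⟨i,r⟩ = ir (concatenation), i = evens x 0,
-- r = evens x ∘ suc and p = odds x.
U : 𝒩 ⇀ 𝒩
U .Dom x = ∀ n → ∃[ m ] φ (evens x 0) ⟪ evens x ∘ suc , odds x ⟫ n m
U .Dom-resp x≗y d n =
  proj₁ (d n) , φ-resp (x≗y _) (⟪⟫-cong (λ _ → x≗y _) (λ _ → x≗y _)) (proj₂ (d n))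
U .app x d n = proj₁ (d n)
U .app-cong {x} {y} x≗y d e n = φ-functional (evens y 0) _
  (φ-resp (x≗y _) (⟪⟫-cong (λ _ → x≗y _) (λ _ → x≗y _)) (proj₂ (d n))) (proj₂ (e n))

record RepresentedSpace : Set₁ where
  field
    Space      : Setoid 0ℓ 0ℓ
    δ          : 𝒩 ⇀ Space
  open Setoid Space public
  field
    surjective : ∀ x → ∃[ p ] Σ (Dom δ p) λ d → app δ p d ≈ x

open RepresentedSpace using (Space; Carrier; δ)

𝔹 : RepresentedSpace
𝔹 = record
  { Space      = 𝒩
  ; δ          = idₚ
  ; surjective = λ p → p , tt , λ _ → refl
  }

-- p = ⟨p₀,p₁,…⟩ for pₙ = section n p, since ⟨p₀,p₁,…⟩⟨n,k⟩ = pₙ(k).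
section : ℕ → Baire → Baire
section n p k = p ⟨ n , k ⟩

tupling : (ℕ → Baire) → Baire
tupling ps m = ps (π₁ m) (π₂ m)

section-tupling : ∀ ps n → section n (tupling ps) ≗ ps n
section-tupling ps n k = cong₂ ps (π₁-pair n k) (π₂-pair n k)

seqSetoid : Setoid 0ℓ 0ℓ → Setoid 0ℓ 0ℓ
seqSetoid A = record
  { Carrier       = ℕ → A.Carrier
  ; _≈_           = λ x y → ∀ n → x n A.≈ y n
  ; isEquivalence = record
    { refl  = λ _ → A.refl
    ; sym   = λ h n → A.sym (h n)
    ; trans = λ h k n → A.trans (h n) (k n)
    }
  }
  where module A = Setoid A

infix 10 _^ℕ
_^ℕ : RepresentedSpace → RepresentedSpace
X ^ℕ = record
  { Space      = seqSetoid X.Space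
  ; δ          = record
    { Dom      = λ p → ∀ n → Dom X.δ (section n p)
    ; Dom-resp = λ p≗q d n → Dom-resp X.δ (λ k → p≗q ⟨ n , k ⟩) (d n)
    ; app      = λ p d n → app X.δ (section n p) (d n)
    ; app-cong = λ p≗q d e n → app-cong X.δ (λ k → p≗q ⟨ n , k ⟩) (d n) (e n)
    }
  ; surjective = λ x →
      let name  = λ n → proj₁ (X.surjective (x n))
          dom   = λ n → proj₁ (proj₂ (X.surjective (x n)))
          names = λ n → proj₂ (proj₂ (X.surjective (x n)))
          eq    = section-tupling name
          dom′  = λ n → Dom-resp X.δ (λ k → sym (eq n k)) (dom n)
      in tupling name , dom′ , λ n → X.trans (app-cong X.δ (eq n) (dom′ n) (dom n)) (names n)
  }
  where module X = RepresentedSpace X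

-- The domain is explicit data: defining it as {x : f(x) ≠ ∅}
-- would make "NON is total" an assertion that has no constructive proof.
-- For the same reason the existence of a realizer is not part of the
-- structure; reducibility is defined for all multi-valued functions.
-- Values outside dom are never used.
infix 3 _⇉_
record _⇉_ (X Y : RepresentedSpace) : Set₁ where
  private
    module X = RepresentedSpace X
    module Y = RepresentedSpace Y
  field
    dom      : X.Carrier → Set
    dom-resp : ∀ {x x′} → x X.≈ x′ → dom x → dom x′
    val      : X.Carrier → Y.Carrier → Set
    val-resp : ∀ {x x′ y y′} → x X.≈ x′ → y Y.≈ y′ → val x y → val x′ y′

open _⇉_ public

_Realizes_ : ∀ {X Y} → 𝒩 ⇀ 𝒩 → X ⇉ Y → Set
_Realizes_ {X} {Y} F f =
  ∀ p (d : Dom (δ X) p) → dom f (app (δ X) p d) →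
  Σ (Dom F p) λ e → Σ (Dom (δ Y) (app F p e)) λ e′ →
  val f (app (δ X) p d) (app (δ Y) (app F p e) e′)

infix 4 _≤sW_ _≡sW_
_≤sW_ : ∀ {X Y Z W} → X ⇉ Y → Z ⇉ W → Set₁
f ≤sW g = Σ (𝒩 ⇀ 𝒩) λ H → Σ (𝒩 ⇀ 𝒩) λ K → Computable H × Computable K ×
  (∀ (G : 𝒩 ⇀ 𝒩) → G Realizes g → (H ∘ₚ G ∘ₚ K) Realizes f)

_≡sW_ : ∀ {X Y Z W} → X ⇉ Y → Z ⇉ W → Set₁
f ≡sW g = f ≤sW g × g ≤sW f

Π : ∀ {X Y} → X ⇉ Y → X ^ℕ ⇉ Y ^ℕ
Π f .dom x                = ∀ n → dom f (x n)
Π f .dom-resp x≈ d n      = dom-resp f (x≈ n) (d n)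
Π f .val x y              = ∀ n → val f (x n) (y n)
Π f .val-resp x≈ y≈ h n   = val-resp f (x≈ n) (y≈ n) (h n)

DIS : 𝔹 ⇉ 𝔹
DIS .dom _ = ⊤
DIS .dom-resp _ _ = tt
DIS .val p q = ¬ (Σ (Dom U p) λ d → app U p d ≗ q)
DIS .val-resp {p} {p′} p≗ q≗ h (d , eq) = h (d′ , λ n →
  trans (app-cong U p≗ d′ d n) (trans (eq n) (sym (q≗ n))))
  where
  d′ = Dom-resp U (λ k → sym (p≗ k)) d

NON : 𝔹 ⇉ 𝔹
NON .dom _ = ⊤
NON .dom-resp _ _ = tt
NON .val p q = ¬ (q ≤T p)
NON .val-resp p≗ q≗ h q′≤p′ =
  h (≤T-resp (λ k → sym (p≗ k)) (λ k → sym (q≗ k)) q′≤p′)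

-- NON ≤ Π DIS is a diagonalization.  The i-th instance xᵢ of DIS is chosen such
-- that U xᵢ is the i-th section of φᵢᵖ; a sequence avoiding all U xᵢ then codes a
-- q that differs from every φᵢᵖ.  Only one program modification s, with
-- φ_{s i}(n) = φᵢ⟨i,n⟩, has to be computed on Gödel numbers: as x = ⟪ ir , p ⟫ has
-- two oracle parts, p itself can be supplied as the oracle of φ_{s i}.
-- Π DIS ≤ NON holds since each U pᵢ is computable from ⟨p₀,p₁,…⟩: any q ≰T ⟨p₀,p₁,…⟩
-- differs from all U pᵢ, and the constant sequence q,q,… is a solution.
module Submission where

open import Defs
open import Data.Nat using (ℕ; zero; suc; _+_; _*_)
open import Data.Nat.Properties using (+-suc)
open import Data.Product using (∃-syntax; Σ; _,_; proj₁; proj₂)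
open import Data.Unit using (⊤; tt)
open import Function using (_∘_)
open import Relation.Binary.PropositionalEquality
  using (_≡_; _≗_; refl; sym; trans; cong; subst₂; module ≡-Reasoning)
open import Relation.Nullary using (¬_)

-- Surjectivity of Cantor pairing.

next-injective : ∀ x y → next x ≡ next y → x ≡ y
next-injective (zero  , k) (zero  , l) refl = refl
next-injective (zero  , k) (suc m , l) ()
next-injective (suc n , k) (zero  , l) ()
next-injective (suc n , k) (suc m , l) refl = refl

next≢0 : ∀ x → ¬ next x ≡ (0 , 0)
next≢0 (zero  , k) ()
next≢0 (suc n , k) ()

unpair-injective : ∀ m n → unpair m ≡ unpair n → m ≡ n
unpair-injective zero    zero    eq = refl
unpair-injective zero    (suc n) eq with () ← next≢0 (unpair n) (sym eq)
unpair-injective (suc m) zero    eq with () ← next≢0 (unpair m) eq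
unpair-injective (suc m) (suc n) eq =
  cong suc (unpair-injective m n (next-injective (unpair m) (unpair n) eq))

-- `unpair` is injective and takes the same value on both sides by `unpair-pair`. This lets a
-- program return its input by splitting and re-pairing it.
pair-unpair : ∀ n → ⟨ π₁ n , π₂ n ⟩ ≡ n
pair-unpair n = unpair-injective _ n (unpair-pair (π₁ n) (π₂ n))

-- Basic programs.

infix 4 _computes_from_
_computes_from_ : Code → (ℕ → ℕ) → Baire → Set
c computes f from p = ∀ n → ⟦ c ⟧ p n (f n)

idᶜ : Code
idᶜ = pairᶜ leftᶜ rightᶜ

idᶜ-computes : ∀ p → idᶜ computes (λ n → n) from p
idᶜ-computes p n = π₁ n , π₂ n , refl , refl , sym (pair-unpair n)

constᶜ : ℕ → Code
constᶜ zero    = zeroᶜ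
constᶜ (suc k) = compᶜ succᶜ (constᶜ k)

constᶜ-computes : ∀ k p → constᶜ k computes (λ _ → k) from p
constᶜ-computes zero    p n = refl
constᶜ-computes (suc k) p n = k , constᶜ-computes k p n , refl

sectionᶜ : Code → ℕ → Code
sectionᶜ c i = compᶜ c (pairᶜ (constᶜ i) idᶜ)

sectionᶜ-computes : ∀ c i p q → c computes q from p → sectionᶜ c i computes section i q from p
sectionᶜ-computes c i p q h n =
  ⟨ i , n ⟩ , (i , n , constᶜ-computes i p n , idᶜ-computes p n , refl) , h ⟨ i , n ⟩

-- Projections of the argument ⟨ a , ⟨ k , r ⟩ ⟩ of the step program of precᶜ.
indexᶜ valueᶜ : Code
indexᶜ = compᶜ leftᶜ rightᶜ
valueᶜ = compᶜ rightᶜ rightᶜ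

indexᶜ-computes : ∀ p a k r → ⟦ indexᶜ ⟧ p ⟨ a , ⟨ k , r ⟩ ⟩ k
indexᶜ-computes p a k r =
  _ , refl , sym (trans (cong π₁ (π₂-pair a ⟨ k , r ⟩)) (π₁-pair k r))

valueᶜ-computes : ∀ p a k r → ⟦ valueᶜ ⟧ p ⟨ a , ⟨ k , r ⟩ ⟩ r
valueᶜ-computes p a k r =
  _ , refl , sym (trans (cong π₂ (π₂-pair a ⟨ k , r ⟩)) (π₂-pair k r))

recᶜ : Code → Code → Code
recᶜ f g = compᶜ (precᶜ f g) (pairᶜ zeroᶜ idᶜ)

recᶜ-computes : ∀ f g p h → ⟦ f ⟧ p 0 (h 0) →
  (∀ k → ⟦ g ⟧ p ⟨ 0 , ⟨ k , h k ⟩ ⟩ (h (suc k))) → recᶜ f g computes h from p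
recᶜ-computes f g p h base step n =
  ⟨ 0 , n ⟩ , (0 , n , refl , idᶜ-computes p n , refl) ,
  subst₂ (λ a k → Prec (⟦ f ⟧ p) (⟦ g ⟧ p) a k (h n))
    (sym (π₁-pair 0 n)) (sym (π₂-pair 0 n)) (go n)
  where
  go : ∀ k → Prec (⟦ f ⟧ p) (⟦ g ⟧ p) 0 k (h k)
  go zero    = base
  go (suc k) = h k , go k , step k

-- The oracle of `U`.

swap : ℕ → ℕ
swap zero          = 1
swap (suc zero)    = 0
swap (suc (suc n)) = suc (suc (swap n))

swap-involutive : ∀ n → swap (swap n) ≡ n
swap-involutive zero          = refl
swap-involutive (suc zero)    = refl
swap-involutive (suc (suc n)) = cong (suc ∘ suc) (swap-involutive n)

-- Course-of-values recursion through the pairs ⟨ swap n , swap (suc n) ⟩.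
swapStepᶜ swapᶜ : Code
swapStepᶜ = pairᶜ (compᶜ rightᶜ valueᶜ) (compᶜ succᶜ (compᶜ succᶜ (compᶜ leftᶜ valueᶜ)))
swapᶜ     = compᶜ leftᶜ (recᶜ (constᶜ ⟨ 1 , 0 ⟩) swapStepᶜ)

swapᶜ-computes : ∀ p → swapᶜ computes swap from p
swapᶜ-computes p n = _ ,
  recᶜ-computes (constᶜ ⟨ 1 , 0 ⟩) swapStepᶜ p (λ k → ⟨ swap k , swap (suc k) ⟩)
    (constᶜ-computes ⟨ 1 , 0 ⟩ p 0)
    (λ k → _ , _ ,
      (_ , valueᶜ-computes p 0 k _ , sym (π₂-pair (swap k) (swap (suc k)))) ,
      (_ , (_ , (_ , valueᶜ-computes p 0 k _ , sym (π₁-pair (swap k) (swap (suc k)))) , refl) , refl) ,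
      refl) n ,
  sym (π₁-pair (swap n) (swap (suc n)))

-- After its first entry, `x` carries `odds x` at the even places and the tail of `evens x` at the
-- odd ones, the reverse of the order in which `U` interleaves them.
⟪tails⟫-swap : ∀ x n → ⟪ evens x ∘ suc , odds x ⟫ n ≡ x (suc (swap n))
⟪tails⟫-swap x zero       = refl
⟪tails⟫-swap x (suc zero) = refl
⟪tails⟫-swap x (suc (suc n)) = begin
  ⟪ evens x ∘ suc , odds x ⟫ (suc (suc n))
    ≡⟨ ⟪⟫-step (evens x ∘ suc) (odds x) n ⟩
  ⟪ evens x ∘ suc ∘ suc , odds x ∘ suc ⟫ n
    ≡⟨ ⟪⟫-cong (λ k → cong x (double (suc k))) (λ k → cong x (cong (_+ 1) (double k))) n ⟩
  ⟪ evens (x ∘ suc ∘ suc) ∘ suc , odds (x ∘ suc ∘ suc) ⟫ n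
    ≡⟨ ⟪tails⟫-swap (x ∘ suc ∘ suc) n ⟩
  x (suc (swap (suc (suc n)))) ∎
  where
  open ≡-Reasoning
  double : ∀ k → 2 * suc k ≡ suc (suc (2 * k))
  double k = cong suc (+-suc k (k + 0))

-- Oracle substitution and Turing reducibility.

infix 8 _[_]
_[_] : Code → Code → Code
zeroᶜ       [ o ] = zeroᶜ
succᶜ       [ o ] = succᶜ
leftᶜ       [ o ] = leftᶜ
rightᶜ      [ o ] = rightᶜ
oracleᶜ     [ o ] = o
(pairᶜ f g) [ o ] = pairᶜ (f [ o ]) (g [ o ])
(compᶜ f g) [ o ] = compᶜ (f [ o ]) (g [ o ])
(precᶜ f g) [ o ] = precᶜ (f [ o ]) (g [ o ])
(rfindᶜ f)  [ o ] = rfindᶜ (f [ o ])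

[]-sound : ∀ {o p q} → o computes q from p →
  ∀ c {n m} → ⟦ c ⟧ q n m → ⟦ c [ o ] ⟧ p n m
[]-sound oq zeroᶜ   e = e
[]-sound oq succᶜ   e = e
[]-sound oq leftᶜ   e = e
[]-sound oq rightᶜ  e = e
[]-sound oq oracleᶜ {n} refl = oq n
[]-sound oq (pairᶜ f g) (a , b , fa , gb , e) = a , b , []-sound oq f fa , []-sound oq g gb , e
[]-sound oq (compᶜ f g) (k , gk , fm) = k , []-sound oq g gk , []-sound oq f fm
[]-sound {o} {p} {q} oq (precᶜ f g) {n} = go (π₂ n)
  where
  go : ∀ k {m} → Prec (⟦ f ⟧ q) (⟦ g ⟧ q) (π₁ n) k m →
       Prec (⟦ f [ o ] ⟧ p) (⟦ g [ o ] ⟧ p) (π₁ n) k m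
  go zero    fm            = []-sound oq f fm
  go (suc k) (r , hr , gm) = r , go k hr , []-sound oq g gm
[]-sound oq (rfindᶜ f) (fm , below) =
  []-sound oq f fm , λ k k<m → proj₁ (below k k<m) , []-sound oq f (proj₂ (below k k<m))

computes⇒≤T : ∀ c {p q} → c computes q from p → q ≤T p
computes⇒≤T c h = gödel c , λ n → c , refl , h n

≤T⇒computes : ∀ {p q} → q ≤T p → ∃[ c ] c computes q from p
≤T⇒computes {p} {q} (i , h) = c , λ n → uniform n (h n)
  where
  -- `φ` supplies a code separately for each `n`; all of them have number `i`, so by injectivity of
  -- `gödel` the one found at input 0 serves everywhere.
  c = proj₁ (h 0)
  uniform : ∀ n → φ i p n (q n) → ⟦ c ⟧ p n (q n)
  uniform n (d , e , hd)
    with refl ← gödel-injective d c (trans e (sym (proj₁ (proj₂ (h 0))))) = hd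

≤T-trans : ∀ {p q r} → r ≤T q → q ≤T p → r ≤T p
≤T-trans r≤q q≤p with c , cr ← ≤T⇒computes r≤q | o , oq ← ≤T⇒computes q≤p =
  computes⇒≤T (c [ o ]) (λ n → []-sound oq c (cr n))

section-≤T : ∀ i p → section i p ≤T p
section-≤T i p =
  computes⇒≤T (sectionᶜ oracleᶜ i) (sectionᶜ-computes oracleᶜ i p p (λ _ → refl))

-- A Turing reduction may depend on `x`, so the index `evens x 0` is fixed in advance; the oracle
-- that it runs on is a computable rearrangement of `x`.
U-≤T : ∀ x (d : Dom U x) → app U x d ≤T x
U-≤T x d = ≤T-trans (evens x 0 , λ n → proj₂ (d n))
  (≤T-resp (λ _ → refl) (λ n → sym (⟪tails⟫-swap x n))
    (computes⇒≤T (compᶜ oracleᶜ (compᶜ succᶜ swapᶜ))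
      (λ n → _ , (_ , swapᶜ-computes x n , refl) , refl)))

-- Computable functionals and the diagonal instances.

total : (f : Baire → Baire) → (∀ {p q} → p ≗ q → f p ≗ f q) → 𝒩 ⇀ 𝒩
total f f-cong = record
  { Dom      = λ _ → ⊤
  ; Dom-resp = λ _ _ → tt
  ; app      = λ p _ → f p
  ; app-cong = λ p≗q _ _ → f-cong p≗q
  }

computes⇒Computable : ∀ c F → (∀ p d → c computes app F p d from p) → Computable F
computes⇒Computable c F h = gödel c , λ p d n → c , refl , h p d n

idₚ-computable : Computable idₚ
idₚ-computable = computes⇒Computable oracleᶜ idₚ (λ p d n → refl)

-- Equals gödel (sectionᶜ c i) if i = gödel c.
diagIndex : ℕ → ℕ
diagIndex i = ⟨ 6 , ⟨ i , gödel (pairᶜ (constᶜ i) idᶜ) ⟩ ⟩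

-- The program `constᶜ i` grows with `i`, so its number is found by recursion. Here 6 is the tag of
-- `compᶜ`; in `diagIndexᶜ`, 5 is that of `pairᶜ`.
gödelConstStepᶜ gödelConstᶜ : Code
gödelConstStepᶜ = pairᶜ (constᶜ 6) (pairᶜ (constᶜ (gödel succᶜ)) valueᶜ)
gödelConstᶜ = recᶜ (constᶜ (gödel zeroᶜ)) gödelConstStepᶜ

gödelConstᶜ-computes : ∀ p → gödelConstᶜ computes (λ i → gödel (constᶜ i)) from p
gödelConstᶜ-computes p =
  recᶜ-computes (constᶜ (gödel zeroᶜ)) gödelConstStepᶜ p
  (λ i → gödel (constᶜ i)) (constᶜ-computes (gödel zeroᶜ) p 0)
  (λ k → 6 , _ , constᶜ-computes 6 p ⟨ 0 , ⟨ k , gödel (constᶜ k) ⟩ ⟩ ,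
    (_ , _ , constᶜ-computes (gödel succᶜ) p ⟨ 0 , ⟨ k , gödel (constᶜ k) ⟩ ⟩ , valueᶜ-computes p 0 k _ , refl) , refl)

diagIndexᶜ : Code
diagIndexᶜ = pairᶜ (constᶜ 6) (pairᶜ idᶜ
  (pairᶜ (constᶜ 5) (pairᶜ gödelConstᶜ (constᶜ (gödel idᶜ)))))

diagIndexᶜ-computes : ∀ p → diagIndexᶜ computes diagIndex from p
diagIndexᶜ-computes p i =
  6 , _ , constᶜ-computes 6 p i , (i , _ , idᶜ-computes p i ,
    (5 , _ , constᶜ-computes 5 p i ,
      (_ , _ , gödelConstᶜ-computes p i , constᶜ-computes (gödel idᶜ) p i , refl) , refl) , refl) , refl

-- diag p i = ⟪ ⟨s,r⟩ , p′ ⟫ with s = diagIndex i and ⟪ r , p′ ⟫ ≗ p.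
diag : Baire → ℕ → Baire
diag p i zero    = diagIndex i
diag p i (suc k) = p (swap k)

diag-oracle : ∀ p i → ⟪ evens (diag p i) ∘ suc , odds (diag p i) ⟫ ≗ p
diag-oracle p i n = trans (⟪tails⟫-swap (diag p i) n) (cong p (swap-involutive n))

-- `precᶜ` unpairs its input just as `tupling` does, and its base and step cases act as the case
-- distinction in `diag`.
diagᶜ : Code
diagᶜ = precᶜ diagIndexᶜ (compᶜ oracleᶜ (compᶜ swapᶜ indexᶜ))

diagᶜ-computes : ∀ p → diagᶜ computes tupling (diag p) from p
diagᶜ-computes p n = go (π₂ n)
  where
  go : ∀ k → Prec (⟦ diagIndexᶜ ⟧ p) (⟦ compᶜ oracleᶜ (compᶜ swapᶜ indexᶜ) ⟧ p)
                  (π₁ n) k (diag p (π₁ n) k)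
  go zero    = diagIndexᶜ-computes p (π₁ n)
  go (suc k) = _ , go k , (swap k , (k , indexᶜ-computes p (π₁ n) k _ , swapᶜ-computes p k) , refl)

U-diag : ∀ {p q} → q ≤T p → ∃[ i ] Σ (Dom U (diag p i)) λ d → app U (diag p i) d ≗ section i q
U-diag {p} {q} q≤p with c , cq ← ≤T⇒computes q≤p =
  -- `gödel c` serves twice: as the program for `q` and as the section of `q` to be matched.
  -- `diagIndex (gödel c)` unfolds to the number of `sectionᶜ c (gödel c)`, whence `refl`.
  gödel c , (λ n → section (gödel c) q n , sectionᶜ c (gödel c) , refl ,
    ⟦⟧-resp (sectionᶜ c (gödel c)) (λ k → sym (diag-oracle p (gödel c) k))
      (sectionᶜ-computes c (gödel c) p q cq n)) ,
  λ n → refl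

diagonal : 𝒩 ⇀ 𝒩
diagonal = total (λ p → tupling (diag p)) diag-cong
  where
  diag-cong : ∀ {p q} → p ≗ q → tupling (diag p) ≗ tupling (diag q)
  diag-cong p≗q m with π₂ m
  ... | zero  = refl
  ... | suc k = p≗q (swap k)

-- The two reductions.

NON≤ΠDIS : NON ≤sW Π DIS
-- The outer map is the identity: a name of the sequence of answers is itself the sought `q`.
NON≤ΠDIS = idₚ , diagonal , idₚ-computable ,
  computes⇒Computable diagᶜ diagonal (λ p _ → diagᶜ-computes p) , realizes
  where
  realizes : ∀ G → G Realizes Π DIS → (idₚ ∘ₚ G ∘ₚ diagonal) Realizes NON
  realizes G real p _ _ with e , e′ , avoids ← real (tupling (diag p)) (λ _ → tt) (λ _ → tt) =
    ((tt , e) , tt) , tt , λ q≤p →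
      let i , U≗q = U-diag q≤p
      -- The `i`-th instance is recovered from the tupled name only up to pointwise equality, so
      -- avoidance is transported.
      in val-resp DIS (section-tupling (diag p) i) (λ _ → refl) (avoids i) U≗q

repeat : 𝒩 ⇀ 𝒩
repeat = total (λ q → tupling (λ _ → q)) (λ p≗q m → p≗q (π₂ m))

ΠDIS≤NON : Π DIS ≤sW NON
-- The inner map is the identity: the joint name of all instances is the oracle to be escaped.
ΠDIS≤NON = repeat , idₚ ,
  computes⇒Computable (compᶜ oracleᶜ rightᶜ) repeat (λ p _ n → _ , refl , refl) ,
  idₚ-computable , realizes
  where
  realizes : ∀ G → G Realizes NON → (repeat ∘ₚ G ∘ₚ idₚ) Realizes Π DIS
  realizes G real p _ _ with e , _ , q≰p ← real p tt tt =
    ((tt , e) , tt) , (λ _ → tt) , λ i (d , U≗q) →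
      q≰p (≤T-resp (λ _ → refl) (λ k → trans (U≗q k) (section-tupling (λ _ → app G p e) i k))
        (≤T-trans (U-≤T (section i p) d) (section-≤T i p)))

theorem1p11 : NON ≡sW Π DIS
theorem1p11 = NON≤ΠDIS , ΠDIS≤NON
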